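{- Let $\langle x_n\rangle_{n=1}^\infty$ be an almost minimal sequence in $(\mathbb{N},+)$ and let $A\subseteq\mathbb{N}$ be a $C^\star$-set in $(\mathbb{N},+)$. Then there exists a sum subsystem $\langle y_n\rangle_{n=1}^\infty$ of $\langle x_n\rangle_{n=1}^\infty$ such that $$FS(\langle y_n\rangle_{n=1}^\infty)\cup FP(\langle y_n\rangle_{n=1}^\infty)\subseteq A.$$
   Context: $\mathbb{N}$ is the set of positive integers, and for a set $X$, $\mathcal{P}_f(X)$ is the set of finite nonempty subsets of $X$. $\beta\mathbb{N}$ is the set of ultrafilters on $\mathbb{N}$ (with points of $\mathbb{N}$ identified with principal ultrafilters), topologized with basis $\{\overline{A}:A\subseteq\mathbb{N}\}$, where $\overline{A}=c\ell A=\{p\in\beta\mathbb{N}:A\in p\}$. Addition extends to $\beta\mathbb{N}$ by: $A\in p+q$ iff $\{x\in\mathbb{N}:-x+A\in q\}\in p$, where $-x+A=\{y\in\mathbb{N}:x+y\in A\}$. An idempotent is $p\in\beta\mathbb{N}$ with $p+p=p$. J-sets: a set $A\subseteq\mathbb{N}$ is a $J$-set (in $(\mathbb{N},+)$) if for every finite nonempty set $F$ of sequences $f:\mathbb{N}\to\mathbb{N}$ there exist $a\in\mathbb{N}$ and $H\in\mathcal{P}_f(\mathbb{N})$ such that $a+\sum_{t\in H}f(t)\in A$ for all $f\in F$. $J(\mathbb{N})=\{p\in\beta\mathbb{N}:\text{every }A\in p\text{ is a }J\text{ -set}\}$. $C^\star$-sets: $A\subseteq\mathbb{N}$ is a $C^\star$-set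 in $(\mathbb{N},+)$ if $A\in p$ for every idempotent $p\in J(\mathbb{N})$. For a sequence $\langle x_n\rangle$ in $\mathbb{N}$ and $m\in\mathbb{N}$, $FS(\langle x_n\rangle_{n=m}^\infty)=\{\sum_{n\in F}x_n:F\in\mathcal{P}_f(\mathbb{N}),\ \min F\ge m\}$ and $FP(\langle x_n\rangle_{n=m}^\infty)=\{\prod_{n\in F}x_n:F\in\mathcal{P}_f(\mathbb{N}),\ \min F\ge m\}$. Almost minimal: a sequence $\langle x_n\rangle_{n=1}^\infty$ in $\mathbb{N}$ is almost minimal if $\bigcap_{m=1}^\infty c\ell\, FS(\langle x_n\rangle_{n=m}^\infty)\cap J(\mathbb{N})\neq\emptyset$. Sum subsystem: $\langle y_n\rangle_{n=1}^\infty$ is a sum subsystem of $\langle x_n\rangle_{n=1}^\infty$ if there is a sequence $\langle H_n\rangle_{n=1}^\infty$ in $\mathcal{P}_f(\mathbb{N})$ with $\max H_n<\min H_{n+1}$ and $y_n=\sum_{t\in H_n}x_t$ for each $n\in\mathbb{N}$. -}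

module Defs where

open import Data.List.NonEmpty using (List⁺; map; foldr₁; head; last; toList)
open import Data.List.NonEmpty.Relation.Unary.All using (All)
open import Data.List.Relation.Unary.AllPairs using (AllPairs)
open import Data.Nat.Base as ℕ using (ℕ; NonZero)
open import Data.Nat.Properties using (m*n≢0)
open import Data.Product.Base using (∃; ∃-syntax; _×_; _,_)
open import Data.Sum.Base using (_⊎_; inj₁; inj₂)
open import Function.Bundles using (_⇔_)
open import Level using (0ℓ; suc)
open import Relation.Binary.PropositionalEquality using (_≡_)
open import Relation.Nullary using (¬_)
open import Relation.Unary
  using (Pred; _∈_; _⊆_; _∩_; ∁; ∅; U; Satisfiable; ⋂)

-- The positivity proof is irrelevant, so propositional equality on ℕ⁺ is
-- equality of the underlying naturals.

record ℕ⁺ : Set where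
  constructor pos
  field
    value           : ℕ
    .{{positive}}   : NonZero value

open ℕ⁺ public

one : ℕ⁺
one = pos 1

infixl 6 _+_
infixl 7 _*_
infix  4 _≤_ _<_

+-nonZero : ∀ m n .{{_ : NonZero m}} → NonZero (m ℕ.+ n)
+-nonZero (ℕ.suc _) _ = _

_+_ : ℕ⁺ → ℕ⁺ → ℕ⁺
pos m + pos n = pos (m ℕ.+ n) {{+-nonZero m n}}

_*_ : ℕ⁺ → ℕ⁺ → ℕ⁺
pos m * pos n = pos (m ℕ.* n) {{m*n≢0 m n}}

_≤_ : ℕ⁺ → ℕ⁺ → Set
m ≤ n = value m ℕ.≤ value n

_<_ : ℕ⁺ → ℕ⁺ → Set
m < n = value m ℕ.< value n

Subset : Set₁
Subset = Pred ℕ⁺ 0ℓ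

Sequence : Set
Sequence = ℕ⁺ → ℕ⁺

-- A finite nonempty set of positive integers is the strictly increasing list of its
-- elements; its minimum and maximum are the ends of that list.

record 𝒫f : Set where
  constructor finite
  field
    elements   : List⁺ ℕ⁺
    increasing : AllPairs _<_ (toList elements)

open 𝒫f public

min : 𝒫f → ℕ⁺
min H = head (elements H)

max : 𝒫f → ℕ⁺
max H = last (elements H)

∑ : 𝒫f → Sequence → ℕ⁺
∑ H x = foldr₁ _+_ (map x (elements H))

∏ : 𝒫f → Sequence → ℕ⁺
∏ H x = foldr₁ _*_ (map x (elements H))

FS : Sequence → ℕ⁺ → Subset
FS x m s = ∃[ F ] m ≤ min F × s ≡ ∑ F x

FP : Sequence → ℕ⁺ → Subset
FP x m s = ∃[ F ] m ≤ min F × s ≡ ∏ F x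

SumSubsystem : Sequence → Sequence → Set
SumSubsystem y x = ∃ λ (H : ℕ⁺ → 𝒫f) →
  (∀ n → max (H n) < min (H (n + one))) × (∀ n → y n ≡ ∑ (H n) x)

record βℕ : Set₁ where
  field
    member : Pred Subset 0ℓ
    whole  : member U
    proper : ¬ member ∅
    upward : ∀ {A B} → A ⊆ B → member A → member B
    meet   : ∀ {A B} → member A → member B → member (A ∩ B)
    ultra  : ∀ A → member A ⊎ member (∁ A)

open βℕ public

-- Subsets are not extensional in Agda, so equality of ultrafilters means
-- having the same members.

infix 4 _≈_
_≈_ : βℕ → βℕ → Set₁
p ≈ q = ∀ A → member p A ⇔ member q A

cl : Subset → Pred βℕ 0ℓ
cl A p = member p A

-_+ˢ_ : ℕ⁺ → Subset → Subset
(- x +ˢ A) y = x + y ∈ A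

infixl 6 _⊕_
_⊕_ : βℕ → βℕ → βℕ
p ⊕ q = record
  { member = λ A → member p (λ x → member q (- x +ˢ A))
  ; whole  = upward p (λ _ → whole q) (whole p)
  ; proper = λ h → proper p (upward p (proper q) h)
  ; upward = λ A⊆B → upward p (upward q A⊆B)
  ; meet   = λ a b → upward p (λ (u , v) → meet q u v) (meet p a b)
  ; ultra  = ultra⊕
  }
  where
  ultra⊕ : ∀ A → member p (λ x → member q (- x +ˢ A)) ⊎
                 member p (λ x → member q (- x +ˢ ∁ A))
  ultra⊕ A with ultra p (λ x → member q (- x +ˢ A))
  ... | inj₁ h = inj₁ h
  ... | inj₂ h = inj₂ (upward p (λ {x} → complement x) h)
    where
    complement : ∀ x → ¬ member q (- x +ˢ A) → member q (- x +ˢ ∁ A)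
    complement x A∉ with ultra q (- x +ˢ A)
    ... | inj₁ A∈ with () ← A∉ A∈
    ... | inj₂ ∁A∈ = ∁A∈

Idempotent : Pred βℕ (suc 0ℓ)
Idempotent p = p ⊕ p ≈ p

-- The finite nonempty set F of sequences is given by a listing; since F
-- is only quantified over, order and repetitions are immaterial.

JSet : Pred Subset 0ℓ
JSet A = ∀ (F : List⁺ Sequence) →
  ∃ λ (a : ℕ⁺) → ∃ λ (H : 𝒫f) → All (λ f → a + ∑ H f ∈ A) F

J : Pred βℕ (suc 0ℓ)
J p = ∀ A → member p A → JSet A

C⋆ : Pred Subset (suc 0ℓ)
C⋆ A = ∀ p → Idempotent p → p ∈ J → member p A

AlmostMinimal : Pred Sequence (suc 0ℓ)
AlmostMinimal x = Satisfiable ((⋂[ m ∶ ℕ⁺ ] cl (FS x m)) ∩ J)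

-- By Ellis's theorem the compact semigroup ⋂ₘ cl FS(x,m) ∩ J contains an idempotent p, and
-- A ∈ p. Moreover z⁻¹A is C⋆ whenever A is: p ↦ z·p preserves idempotency and J, since A is a
-- J-set if z⁻¹A is (regroup the sequences into blocks whose sums are divisible by z). The
-- terms of y are then chosen one by one, each from a member of p: if sums were confined to
-- B ∈ p and products to a C⋆-set D so far, then after choosing the term t they are confined
-- to B ∩ (−t + B), which can be kept in p as p + p = p, and to D ∩ t⁻¹D, again a C⋆-set.
module Submission where

open import Defs
open import Axiom.ExcludedMiddle using (ExcludedMiddle)
open import Axiom.Extensionality.Propositional using (Extensionality)
open import Data.Bool.Base using (Bool; true; false; not)
open import Data.Empty using (⊥-elim)
open import Data.Fin.Base using (toℕ; fromℕ<)
open import Data.Fin.Properties using (pigeonhole; toℕ-fromℕ<)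
open import Data.List.Base as List using (List; []; _∷_)
open import Data.List.NonEmpty as List⁺ using (_∷_; last; toList; foldr₁; _⁺++⁺_)
open import Data.List.NonEmpty.Relation.Unary.All as All⁺ using (_∷_)
open import Data.List.Relation.Unary.All as All using (All; []; _∷_)
import Data.List.Relation.Unary.All.Properties as Allₚ
open import Data.List.Relation.Unary.AllPairs using (AllPairs; []; _∷_)
import Data.List.Relation.Unary.AllPairs.Properties as AllPairsₚ
open import Data.Nat.Base as ℕ using (ℕ; zero; suc; NonZero)
open import Data.Nat.Divisibility using (_∣_; divides; ∣m+n∣m⇒∣n)
open import Data.Nat.DivMod using (_/_; _%_; m≡m%n+[m/n]*n; m%n<n)
import Data.Nat.Properties as ℕₚ
open import Data.Product.Base using (∃; _×_; _,_; proj₁; proj₂)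
open import Data.Sum.Base using (_⊎_; inj₁; inj₂; [_,_]′)
open import Function.Base using (_∘_; id)
open import Function.Bundles using (mk⇔; Equivalence)
open import Level using (0ℓ)
open import Relation.Binary.PropositionalEquality
  using (_≡_; refl; sym; trans; cong; cong₂; subst; module ≡-Reasoning)
open import Relation.Nullary using (¬_; yes; no; does; contradiction)
open import Relation.Unary using (Pred; _∈_; _⊆_; _∪_; _∩_; ∁; ∅; U)

-- Arithmetic of the positive integers

private variable
  k m n : ℕ⁺

value-injective : value m ≡ value n → m ≡ n
value-injective refl = refl

+-assoc : ∀ k m n → (k + m) + n ≡ k + (m + n)
+-assoc k m n = value-injective (ℕₚ.+-assoc (value k) (value m) (value n))

+-comm : ∀ m n → m + n ≡ n + m
+-comm m n = value-injective (ℕₚ.+-comm (value m) (value n))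

*-assoc : ∀ k m n → (k * m) * n ≡ k * (m * n)
*-assoc k m n = value-injective (ℕₚ.*-assoc (value k) (value m) (value n))

*-distribˡ-+ : ∀ k m n → k * (m + n) ≡ k * m + k * n
*-distribˡ-+ k m n = value-injective (ℕₚ.*-distribˡ-+ (value k) (value m) (value n))

+one≤⇒< : m + one ≤ n → m < n
+one≤⇒< {m} {n} m+1≤n = subst (ℕ._≤ value n) (ℕₚ.+-comm (value m) 1) m+1≤n

m<m+one : ∀ m → m < m + one
m<m+one m = +one≤⇒< {m} {m + one} ℕₚ.≤-refl

index : ℕ⁺ → ℕ
index = ℕ.pred ∘ value

index-mono-< : m < n → index m ℕ.< index n
index-mono-< {pos (suc _)} {pos (suc _)} m<n = ℕₚ.≤-pred m<n

index-+one : ∀ n → index (n + one) ≡ suc (index n)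
index-+one (pos (suc n)) = ℕₚ.+-comm n 1

-- Divisibility

infix 4 _∣⁺_

_∣⁺_ : ℕ⁺ → ℕ⁺ → Set
m ∣⁺ n = ∃ λ q → m * q ≡ n

∣⇒∣⁺ : value m ∣ value n → m ∣⁺ n
∣⇒∣⁺ {n = pos n} (divides zero eq) = contradiction eq (ℕ.≢-nonZero⁻¹ n)
∣⇒∣⁺ {m} (divides (suc q) eq) =
  pos (suc q) , value-injective (trans (ℕₚ.*-comm (value m) (suc q)) (sym eq))

%-≡⇒∣ : ∀ m n d .{{_ : NonZero d}} → m % d ≡ (m ℕ.+ n) % d → d ∣ n
%-≡⇒∣ m n d eq = ∣m+n∣m⇒∣n (divides ((m ℕ.+ n) / d) cancelled) (divides (m / d) refl)
  where
  open ≡-Reasoning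
  cancelled : m / d ℕ.* d ℕ.+ n ≡ (m ℕ.+ n) / d ℕ.* d
  cancelled = ℕₚ.+-cancelˡ-≡ (m % d) _ _ (begin
    m % d ℕ.+ (m / d ℕ.* d ℕ.+ n)            ≡⟨ ℕₚ.+-assoc (m % d) _ n ⟨
    m % d ℕ.+ m / d ℕ.* d ℕ.+ n              ≡⟨ cong (ℕ._+ n) (m≡m%n+[m/n]*n m d) ⟨
    m ℕ.+ n                                  ≡⟨ m≡m%n+[m/n]*n (m ℕ.+ n) d ⟩
    (m ℕ.+ n) % d ℕ.+ (m ℕ.+ n) / d ℕ.* d    ≡⟨ cong (ℕ._+ (m ℕ.+ n) / d ℕ.* d) eq ⟨
    m % d ℕ.+ (m ℕ.+ n) / d ℕ.* d            ∎)

-- Finite sets and their sums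

last-∷ : ∀ {A : Set} (x y : A) ys → last (x ∷ y ∷ ys) ≡ last (y ∷ ys)
last-∷ x y ys with List.initLast ys
... | []            = refl
... | _ List.∷ʳ′ _  = refl

all≤last : ∀ x xs → AllPairs _<_ (x ∷ xs) → All (_≤ last (x ∷ xs)) (x ∷ xs)
all≤last x []       _                   = ℕₚ.≤-refl ∷ []
all≤last x (y ∷ ys) ((x<y ∷ _) ∷ inc) =
  subst (λ l → All (_≤ l) (x ∷ y ∷ ys)) (sym (last-∷ x y ys))
    (ℕₚ.≤-trans (ℕₚ.<⇒≤ x<y) (All.head rest) ∷ rest)
  where rest = all≤last y ys inc

all≤max : ∀ H → All (_≤ max H) (toList (elements H))
all≤max H = all≤last _ _ (increasing H)

head≤all : ∀ {x xs} → AllPairs _<_ (x ∷ xs) → All (x ≤_) (x ∷ xs)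
head≤all (x< ∷ _) = ℕₚ.≤-refl ∷ All.map ℕₚ.<⇒≤ x<

min≤all : ∀ H → All (min H ≤_) (toList (elements H))
min≤all H = head≤all (increasing H)

min≤max : ∀ H → min H ≤ max H
min≤max H = All.head (all≤max H)

singleton : ℕ⁺ → 𝒫f
singleton n = finite (n ∷ []) ([] ∷ [])

append : ∀ H K → max H < min K → 𝒫f
append H K H<K = finite (elements H ⁺++⁺ elements K)
  (AllPairsₚ.++⁺ (increasing H) (increasing K)
    (All.map (λ x≤max → All.map (λ min≤y → ℕₚ.≤-<-trans x≤max (ℕₚ.<-≤-trans H<K min≤y))
                                (min≤all K))
             (all≤max H)))

∑-append : ∀ H K (H<K : max H < min K) f → ∑ (append H K H<K) f ≡ ∑ H f + ∑ K f
∑-append H K _ f = go _ (List⁺.tail (elements H))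
  where
  go : ∀ x xs → foldr₁ _+_ (List⁺.map f ((x ∷ xs) ⁺++⁺ elements K)) ≡
                foldr₁ _+_ (List⁺.map f (x ∷ xs)) + ∑ K f
  go x []       = refl
  go x (y ∷ ys) = trans (cong (f x +_) (go y ys))
    (sym (+-assoc (f x) (foldr₁ _+_ (List⁺.map f (y ∷ ys))) (∑ K f)))

*-∑ : ∀ z {f g} → (∀ i → z * f i ≡ g i) → ∀ H → z * ∑ H f ≡ ∑ H g
*-∑ z {f} {g} zf≡g H = go _ (List⁺.tail (elements H))
  where
  go : ∀ x xs → z * foldr₁ _+_ (List⁺.map f (x ∷ xs)) ≡ foldr₁ _+_ (List⁺.map g (x ∷ xs))
  go x []       = zf≡g x
  go x (y ∷ ys) = trans (*-distribˡ-+ z (f x) (foldr₁ _+_ (List⁺.map f (y ∷ ys))))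
    (cong₂ _+_ (zf≡g x) (go y ys))

-- Block sequences

Blocks : (ℕ⁺ → 𝒫f) → Set
Blocks H = ∀ {i j} → i < j → max (H i) < min (H j)

-- `L` is the union of the blocks selected by `K`. It does not depend on `f`, so one regrouping
-- serves all sequences at once.
merge : ∀ {H} → Blocks H → ∀ K → ∃ λ L →
  min L ≡ min (H (min K)) × (∀ f → ∑ L f ≡ ∑ K (λ i → ∑ (H i) f))
merge {H} blocks K = go _ _ (increasing K)
  where
  go : ∀ i is → AllPairs _<_ (i ∷ is) → ∃ λ L →
    min L ≡ min (H i) × (∀ f → ∑ L f ≡ foldr₁ _+_ (List⁺.map (λ i → ∑ (H i) f) (i ∷ is)))
  go i []       _                 = H i , refl , λ _ → refl
  go i (j ∷ is) ((i<j ∷ _) ∷ inc) =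
    let L , minL , sumL = go j is inc
        H<L = subst (λ l → max (H i) < l) (sym minL) (blocks i<j)
    in append (H i) L H<L , refl ,
       λ f → trans (∑-append (H i) L H<L f) (cong (∑ (H i) f +_) (sumL f))

blockSequence : ∀ {Q : 𝒫f → Set} → (∀ l → ∃ λ H → l < min H × Q H) →
  ∀ l → ∃ λ (H : ℕ⁺ → 𝒫f) → Blocks H × (∀ i → l < min (H i)) × (∀ i → Q (H i))
blockSequence {Q} next l =
  block ∘ index , (λ {i} {j} i<j → blocks (index-mono-< {i} {j} i<j)) , (λ i → l<block (index i)) ,
  (λ i → holds (index i))
  where
  block : ℕ → 𝒫f
  block zero    = proj₁ (next l)
  block (suc n) = proj₁ (next (max (block n)))

  holds : ∀ n → Q (block n)
  holds zero    = proj₂ (proj₂ (next l))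
  holds (suc n) = proj₂ (proj₂ (next (max (block n))))

  consecutive : ∀ n → max (block n) < min (block (suc n))
  consecutive n = proj₁ (proj₂ (next (max (block n))))

  blocks : ∀ {i j} → i ℕ.< j → max (block i) < min (block j)
  blocks {i} {suc j} i<1+j with ℕₚ.m<1+n⇒m<n∨m≡n i<1+j
  ... | inj₂ refl = consecutive j
  ... | inj₁ i<j  = ℕₚ.<-trans (ℕₚ.<-≤-trans (blocks i<j) (min≤max (block j))) (consecutive j)

  l<block : ∀ n → l < min (block n)
  l<block zero    = proj₁ (proj₂ (next l))
  l<block (suc n) = ℕₚ.<-trans (l<block n) (ℕₚ.≤-<-trans (min≤max (block n)) (consecutive n))

-- Prefix sums and sums divisible by a given number

from : ℕ → ℕ → List ℕ⁺
from i zero    = []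
from i (suc d) = pos (suc i) ∷ from (suc i) d

from-increasing : ∀ i d → AllPairs _<_ (from i d)
from-increasing i zero    = []
from-increasing i (suc d) = above ℕₚ.≤-refl d ∷ from-increasing (suc i) d
  where
  above : ∀ {i j} → i ℕ.< j → ∀ d → All (pos (suc i) <_) (from j d)
  above i<j zero    = []
  above i<j (suc d) = ℕ.s≤s i<j ∷ above (ℕₚ.m<n⇒m<1+n i<j) d

interval : ℕ → ℕ → 𝒫f
interval i d = finite (pos (suc i) ∷ from (suc i) d) (from-increasing i (suc d))

prefix : Sequence → ℕ → ℕ
prefix s zero    = 0
prefix s (suc n) = prefix s n ℕ.+ value (s (pos (suc n)))

prefix-interval : ∀ s i d → prefix s (suc i ℕ.+ d) ≡ prefix s i ℕ.+ value (∑ (interval i d) s)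
prefix-interval s i zero    = cong (prefix s ∘ suc) (ℕₚ.+-identityʳ i)
prefix-interval s i (suc d) = begin
  prefix s (suc i ℕ.+ suc d)
    ≡⟨ cong (prefix s ∘ suc) (ℕₚ.+-suc i d) ⟩
  prefix s (suc (suc i) ℕ.+ d)
    ≡⟨ prefix-interval s (suc i) d ⟩
  prefix s i ℕ.+ value (s (pos (suc i))) ℕ.+ value (∑ (interval (suc i) d) s)
    ≡⟨ ℕₚ.+-assoc (prefix s i) _ _ ⟩
  prefix s i ℕ.+ value (∑ (interval i (suc d)) s)
    ∎
  where open ≡-Reasoning

-- Two of the first z + 1 prefix sums agree modulo z.
∃-∣⁺∑ : ∀ z s → ∃ λ K → z ∣⁺ ∑ K s
∃-∣⁺∑ z@(pos (suc _)) s
  with i , j , i<j , eq ← pigeonhole (ℕₚ.n<1+n (value z))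
         (λ i → fromℕ< (m%n<n (prefix s (toℕ i)) (value z)))
  -- `i<j` means `suc i ≤ j`, so j = i + 1 + d, and `interval i d` is the nonempty index set from i
  -- + 1 to j.
  with d , i+d≡j ← ℕₚ.m≤n⇒∃[o]m+o≡n i<j =
  interval (toℕ i) d ,
  ∣⇒∣⁺ (%-≡⇒∣ (prefix s (toℕ i)) (value (∑ (interval (toℕ i) d) s)) (value z) (begin
    prefix s (toℕ i) % value z
      ≡⟨ toℕ-fromℕ< _ ⟨
    toℕ (fromℕ< (m%n<n (prefix s (toℕ i)) (value z)))
      ≡⟨ cong toℕ eq ⟩
    toℕ (fromℕ< (m%n<n (prefix s (toℕ j)) (value z)))
      ≡⟨ toℕ-fromℕ< _ ⟩
    prefix s (toℕ j) % value z
      ≡⟨ cong (λ k → prefix s k % value z) i+d≡j ⟨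
    prefix s (suc (toℕ i) ℕ.+ d) % value z
      ≡⟨ cong (_% value z) (prefix-interval s (toℕ i) d) ⟩
    (prefix s (toℕ i) ℕ.+ value (∑ (interval (toℕ i) d) s)) % value z
      ∎))
  where open ≡-Reasoning

-- Induction on the list: the tail gives blocks whose sums are divisible for all of `fs`, and
-- `∃-∣⁺∑` applied to the block sums of `f` selects blocks whose total is divisible for `f` too.
-- Sums of multiples of `z` stay multiples, so nothing is lost for `fs`.
∃-∣⁺∑-common : ∀ z fs l → ∃ λ H → l < min H × All (λ f → z ∣⁺ ∑ H f) fs
∃-∣⁺∑-common z []       l = singleton (l + one) , m<m+one l , []
∃-∣⁺∑-common z (f ∷ fs) l =
  let H , blocks , l<H , divs = blockSequence (∃-∣⁺∑-common z fs) l
      K , div                 = ∃-∣⁺∑ z (λ i → ∑ (H i) f)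
      L , minL , sumL         = merge {H} blocks K
      total : ∀ {g} → z ∣⁺ ∑ K (λ i → ∑ (H i) g) → z ∣⁺ ∑ L g
      total = subst (z ∣⁺_) (sym (sumL _))
  in L , subst (l <_) (sym minL) (l<H (min K)) ,
     total div ∷ All.tabulate (λ g∈fs → total (∣⁺∑ (λ i → All.lookup (divs i) g∈fs) K))
  where
  ∣⁺∑ : ∀ {s} → (∀ i → z ∣⁺ s i) → ∀ K → z ∣⁺ ∑ K s
  ∣⁺∑ {s} z∣s K = ∑ K (λ i → proj₁ (z∣s i)) ,
    *-∑ z {λ i → proj₁ (z∣s i)} {s} (λ i → proj₂ (z∣s i)) K

-- Subsets coded by Boolean functions live in Set, so that excluded middle applies to
-- statements quantifying over families of them.
Coded : Set → Set
Coded X = X → Bool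

El : {X : Set} → Coded X → Pred X 0ℓ
El A x = A x ≡ true

infix 4 _⊑_
_⊑_ : {X : Set} → Coded X → Coded X → Set
A ⊑ B = El A ⊆ El B

El-not : {X : Set} (A : Coded X) → ∁ (El A) ⊆ El (not ∘ A)
El-not A {x} x∉A with A x
... | true  = contradiction refl x∉A
... | false = refl

El-not⁻ : {X : Set} (A : Coded X) → El (not ∘ A) ⊆ ∁ (El A)
El-not⁻ A {x} x∈A with A x
El-not⁻ A {x} () | true
... | false = λ ()

module Classical (em : ExcludedMiddle 0ℓ) (ext : Extensionality 0ℓ 0ℓ) where

  by-contradiction : {P : Set} → ¬ ¬ P → P
  by-contradiction {P} ¬¬p with em {P}
  ... | yes p = p
  ... | no ¬p = contradiction ¬p ¬¬p

  char : {X : Set} → Pred X 0ℓ → Coded X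
  char P x = does (em {P x})

  ∈-char⁺ : {X : Set} (P : Pred X 0ℓ) → P ⊆ El (char P)
  ∈-char⁺ P {x} px with em {P x}
  ... | yes _  = refl
  ... | no ¬px = contradiction px ¬px

  ∈-char⁻ : {X : Set} (P : Pred X 0ℓ) → El (char P) ⊆ P
  ∈-char⁻ P {x} with em {P x}
  ... | yes px = λ _ → px
  ... | no _   = λ ()

  -- Extensionality turns mutual inclusion into equality of codes, so that `step` can be transported
  -- along it.
  ⊑-antisym : {X : Set} {A B : Coded X} → A ⊑ B → B ⊑ A → A ≡ B
  ⊑-antisym {A = A} {B} A⊑B B⊑A = ext (λ x → agree (A x) (B x) A⊑B B⊑A)
    where
    agree : ∀ a b → (a ≡ true → b ≡ true) → (b ≡ true → a ≡ true) → a ≡ b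
    agree true  b     f g = sym (f refl)
    agree false true  f g = g refl
    agree false false f g = refl

  -- Unions of coded families

  InSome : {X : Set} → Coded (Coded X) → Pred X 0ℓ
  InSome C x = ∃ λ A → A ∈ El C × x ∈ El A

  ⋃ : {X : Set} → Coded (Coded X) → Coded X
  ⋃ C = char (InSome C)

  ⊑-⋃ : {X : Set} (C : Coded (Coded X)) {A : Coded X} → A ∈ El C → A ⊑ ⋃ C
  ⊑-⋃ C A∈C x∈A = ∈-char⁺ (InSome C) (_ , A∈C , x∈A)

  ⋃-least : {X : Set} (C : Coded (Coded X)) {B : Coded X} → (∀ A → A ∈ El C → A ⊑ B) → ⋃ C ⊑ B
  ⋃-least C bound x∈⋃ with A , A∈C , x∈A ← ∈-char⁻ (InSome C) x∈⋃ = bound A A∈C x∈A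

  Chain : {X : Set} → Coded (Coded X) → Set
  Chain C = ∀ {A B} → A ∈ El C → B ∈ El C → A ⊑ B ⊎ B ⊑ A

  -- Zorn's lemma, by the Bourbaki–Witt argument: the tower of sets generated from the start
  -- by a choice of strict extensions and by unions is a chain.
  module Zorn {X : Set} (P : Pred (Coded X) 0ℓ) (start : Coded X) (P-start : P start)
              (P-⋃ : ∀ C → ∃ (El C) → El C ⊆ P → Chain C → P (⋃ C)) where

    Extension : Coded X → Pred (Coded X) 0ℓ
    Extension A B = P B × A ⊑ B × ¬ B ⊑ A

    step : Coded X → Coded X
    step A with em {∃ (Extension A)}
    ... | yes (B , _) = B
    ... | no _        = A

    ⊑-step : ∀ A → A ⊑ step A
    ⊑-step A with em {∃ (Extension A)}
    ... | yes (_ , _ , A⊑B , _) = A⊑B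
    ... | no _                  = id

    P-step : ∀ A → P A → P (step A)
    P-step A pA with em {∃ (Extension A)}
    ... | yes (_ , pB , _) = pB
    ... | no _             = pA

    -- `step` moves strictly whenever a strict extension satisfying `P` exists.
    step-⊑⇒maximal : ∀ A → step A ⊑ A → ∀ B → P B → A ⊑ B → B ⊑ A
    step-⊑⇒maximal A with em {∃ (Extension A)}
    ... | yes (_ , _ , _ , B⋢A) = λ B⊑A → ⊥-elim (B⋢A B⊑A)
    ... | no none = λ _ B pB A⊑B → by-contradiction (λ B⋢A → none (B , pB , A⊑B , B⋢A))

    -- `limit` admits every nonempty family of tower sets, so the union of the whole tower is a
    -- tower set; `tower-chain` shows afterwards that such families are chains.
    data Tower : Pred (Coded X) 0ℓ where
      base  : Tower start
      next  : ∀ {A} → Tower A → Tower (step A)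
      limit : ∀ C → ∃ (El C) → (∀ {A} → A ∈ El C → Tower A) → Tower (⋃ C)

    start-⊑ : ∀ {A} → Tower A → start ⊑ A
    start-⊑ base                     = id
    start-⊑ (next tA)                = ⊑-step _ ∘ start-⊑ tA
    start-⊑ (limit C (A , A∈C) towers) = ⊑-⋃ C A∈C ∘ start-⊑ (towers A∈C)

    Extreme : Pred (Coded X) 0ℓ
    Extreme E = ∀ {A} → Tower A → A ⊑ E → ¬ E ⊑ A → step A ⊑ E

    -- Induction on `A`. At a successor with `A ⊑ E`, either `E` is not below `A` and extremality
    -- applies, or the two coincide and so do their steps.
    compare : ∀ {A E} → Tower E → Extreme E → Tower A → A ⊑ E ⊎ step E ⊑ A
    compare tE extreme base = inj₁ (start-⊑ tE)
    compare {E = E} tE extreme (next {A} tA) with compare tE extreme tA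
    ... | inj₂ stepE⊑A = inj₂ (⊑-step A ∘ stepE⊑A)
    ... | inj₁ A⊑E with em {E ⊑ A}
    ...   | no E⋢A  = inj₁ (extreme tA A⊑E E⋢A)
    ...   | yes E⊑A = inj₂ (subst (λ B → step E ⊑ step B) (⊑-antisym E⊑A A⊑E) id)
    compare {E = E} tE extreme (limit C _ towers) with em {∃ λ A → A ∈ El C × step E ⊑ A}
    ... | yes (A , A∈C , stepE⊑A) = inj₂ (⊑-⋃ C A∈C ∘ stepE⊑A)
    ... | no none = inj₁ (⋃-least C (λ A A∈C → below A∈C (compare tE extreme (towers A∈C))))
      where
      below : ∀ {A} → A ∈ El C → A ⊑ E ⊎ step E ⊑ A → A ⊑ E
      below A∈C (inj₁ A⊑E)     = A⊑E
      below A∈C (inj₂ stepE⊑A) = ⊥-elim (none (_ , A∈C , stepE⊑A))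

    tower-extreme : ∀ {E} → Tower E → Extreme E
    tower-extreme base tA A⊑E E⋢A = ⊥-elim (E⋢A (start-⊑ tA))
    tower-extreme (next {E} tE) {A} tA A⊑stepE stepE⋢A with compare tE (tower-extreme tE) tA
    ... | inj₂ stepE⊑A = ⊥-elim (stepE⋢A stepE⊑A)
    ... | inj₁ A⊑E with em {E ⊑ A}
    ...   | no E⋢A  = ⊑-step E ∘ tower-extreme tE tA A⊑E E⋢A
    ...   | yes E⊑A = subst (λ B → step A ⊑ step B) (⊑-antisym A⊑E E⊑A) id
    tower-extreme (limit C nonempty towers) {A} tA A⊑⋃ ⋃⋢A =
      let E , E∈C , stepE⋢A = above in finish E∈C stepE⋢A
      where
      -- Otherwise every `E` in `C` satisfies `E ⊑ step E ⊑ A`, whence `⋃ C ⊑ A`.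
      above : ∃ λ E → E ∈ El C × ¬ step E ⊑ A
      above = by-contradiction (λ none → ⋃⋢A (⋃-least C (λ E E∈C →
        by-contradiction {step E ⊑ A} (λ stepE⋢A → none (E , E∈C , stepE⋢A)) ∘ ⊑-step E)))

      finish : ∀ {E} → E ∈ El C → ¬ step E ⊑ A → step A ⊑ ⋃ C
      finish {E} E∈C stepE⋢A with compare (towers E∈C) (tower-extreme (towers E∈C)) tA
      ... | inj₂ stepE⊑A = ⊥-elim (stepE⋢A stepE⊑A)
      ... | inj₁ A⊑E with em {E ⊑ A}
      ...   | no E⋢A = ⊑-⋃ C E∈C ∘ tower-extreme (towers E∈C) tA A⊑E E⋢A
      -- Here `A` equals `E`, and comparing the union itself with `E` puts `step E` below the union.
      ...   | yes E⊑A with compare (towers E∈C) (tower-extreme (towers E∈C)) (limit C nonempty towers)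
      ...     | inj₁ ⋃⊑E     = ⊥-elim (⋃⋢A (E⊑A ∘ ⋃⊑E))
      ...     | inj₂ stepE⊑⋃ = subst (λ B → step B ⊑ ⋃ C) (⊑-antisym E⊑A A⊑E) stepE⊑⋃

    tower-chain : ∀ {A B} → Tower A → Tower B → A ⊑ B ⊎ B ⊑ A
    tower-chain {B = B} tA tB with compare tB (tower-extreme tB) tA
    ... | inj₁ A⊑B     = inj₁ A⊑B
    ... | inj₂ stepB⊑A = inj₂ (stepB⊑A ∘ ⊑-step B)

    tower-P : Tower ⊆ P
    tower-P base      = P-start
    tower-P (next tA) = P-step _ (tower-P tA)
    tower-P (limit C nonempty towers) =
      P-⋃ C nonempty (λ A∈C → tower-P (towers A∈C))
        (λ A∈C B∈C → tower-chain (towers A∈C) (towers B∈C))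

    maximal : ∃ λ M → P M × start ⊑ M × (∀ B → P B → M ⊑ B → B ⊑ M)
    maximal = top , tower-P top-tower , start-⊑ top-tower ,
      step-⊑⇒maximal top (⊑-⋃ (char Tower) (∈-char⁺ Tower (next top-tower)))
      where
      top : Coded X
      top = ⋃ (char Tower)

      top-tower : Tower top
      top-tower = limit (char Tower) (start , ∈-char⁺ Tower base) (∈-char⁻ Tower)

  -- Ultrafilters

  member-nonempty : ∀ p {A} → member p A → ∃ A
  member-nonempty p {A} A∈p with em {∃ A}
  ... | yes ∃A = ∃A
  ... | no ∄A  = ⊥-elim (proper p (upward p (λ a → ∄A (_ , a)) A∈p))

  member-All : ∀ p {I : Set} {B : I → Subset} {is : List I} → All (λ i → member p (B i)) is →
    member p (λ n → All (λ i → n ∈ B i) is)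
  member-All p []             = upward p (λ _ → []) (whole p)
  member-All p (B∈p ∷ Bs∈p) = upward p (λ (b , bs) → b ∷ bs) (meet p B∈p (member-All p Bs∈p))

  -- Ultrafilters are maximal filters: a set in `q` but not in `p` would have its complement in `p`,
  -- hence in `q`.
  ⊆⇒≈ : ∀ {p q} → member p ⊆ member q → p ≈ q
  ⊆⇒≈ {p} {q} p⊆q A = mk⇔ p⊆q back
    where
    back : member q A → member p A
    back A∈q with ultra p A
    ... | inj₁ A∈p  = A∈p
    ... | inj₂ ∁A∈p =
      ⊥-elim (proper q (upward q (λ (a , ¬a) → ¬a a) (meet q A∈q (p⊆q ∁A∈p))))

  ≈-refl : ∀ {p} → p ≈ p
  ≈-refl _ = mk⇔ id id

  ≈-sym : ∀ {p q} → p ≈ q → q ≈ p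
  ≈-sym p≈q A = mk⇔ (Equivalence.from (p≈q A)) (Equivalence.to (p≈q A))

  ≈-trans : ∀ {p q r} → p ≈ q → q ≈ r → p ≈ r
  ≈-trans p≈q q≈r A = mk⇔ (Equivalence.to (q≈r A) ∘ Equivalence.to (p≈q A))
                          (Equivalence.from (p≈q A) ∘ Equivalence.from (q≈r A))

  ⊕-cong : ∀ {p p′ q q′} → p ≈ p′ → q ≈ q′ → p ⊕ q ≈ p′ ⊕ q′
  ⊕-cong {p} {p′} {q} {q′} p≈p′ q≈q′ = ⊆⇒≈ {p ⊕ q} {p′ ⊕ q′} (λ A∈ →
    Equivalence.to (p≈p′ _) (upward p (Equivalence.to (q≈q′ _)) A∈))

  ⊕-assoc : ∀ p q r → (p ⊕ q) ⊕ r ≈ p ⊕ (q ⊕ r)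
  ⊕-assoc p q r = ⊆⇒≈ {(p ⊕ q) ⊕ r} {p ⊕ (q ⊕ r)} (λ {A} →
    upward p (λ {x} → upward q (λ {y} → upward r (λ {z} → subst A (+-assoc x y z)))))

  -- Finite intersection property and compactness

  Family : Set
  Family = Coded (Coded ℕ⁺)

  FIP : Pred Family 0ℓ
  FIP 𝓕 = ∀ Bs → All (_∈ El 𝓕) Bs → ∃ λ n → All (λ B → n ∈ El B) Bs

  record IsUltra (𝓤 : Family) : Set where
    field
      fip    : FIP 𝓤
      decide : ∀ B → B ∈ El 𝓤 ⊎ not ∘ B ∈ El 𝓤

  open IsUltra

  -- Otherwise the complement of `B` is in `𝓤`, and the finite intersection property gives a point
  -- of all of `Bs` outside `B`.
  closed : ∀ {𝓤} → IsUltra 𝓤 → ∀ {Bs B} → All (_∈ El 𝓤) Bs →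
    (∀ {n} → All (λ C → n ∈ El C) Bs → n ∈ El B) → B ∈ El 𝓤
  closed u {Bs} {B} Bs∈𝓤 Bs⊆B with decide u B
  ... | inj₁ B∈𝓤  = B∈𝓤
  ... | inj₂ ¬B∈𝓤 with n , n∉B ∷ n∈Bs ← fip u (not ∘ B ∷ Bs) (¬B∈𝓤 ∷ Bs∈𝓤) =
    ⊥-elim (El-not⁻ B n∉B (Bs⊆B n∈Bs))

  decode : ∀ 𝓤 → IsUltra 𝓤 → βℕ
  decode 𝓤 u = record
    { member = λ A → char A ∈ El 𝓤
    ; whole  = closed u [] (λ {n} _ → ∈-char⁺ U {n} _)
    ; proper = λ ∅∈𝓤 → let n , n∈∅ = fip u _ (∅∈𝓤 ∷ []) in ∈-char⁻ ∅ {n} (All.head n∈∅)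
    ; upward = λ {A} {B} A⊆B A∈𝓤 →
        closed u (A∈𝓤 ∷ []) (λ { (a ∷ []) → ∈-char⁺ B (A⊆B (∈-char⁻ A a)) })
    ; meet   = λ {A} {B} A∈𝓤 B∈𝓤 → closed u (A∈𝓤 ∷ B∈𝓤 ∷ [])
        (λ { (a ∷ b ∷ []) → ∈-char⁺ (A ∩ B) (∈-char⁻ A a , ∈-char⁻ B b) })
    ; ultra  = λ A → [ inj₁ , (λ ¬A∈𝓤 → inj₂ (closed u (¬A∈𝓤 ∷ [])
        (λ { (n∉A ∷ []) → ∈-char⁺ (∁ A) (El-not⁻ (char A) n∉A ∘ ∈-char⁺ A) }))) ]′
        (decide u (char A))
    }

  code : βℕ → Family
  code p = char (λ B → member p (El B))

  ∈-code⁺ : ∀ p {B} → member p (El B) → B ∈ El (code p)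
  ∈-code⁺ p = ∈-char⁺ (λ B → member p (El B))

  ∈-code⁻ : ∀ p {B} → B ∈ El (code p) → member p (El B)
  ∈-code⁻ p = ∈-char⁻ (λ B → member p (El B))

  code-ultra : ∀ p → IsUltra (code p)
  code-ultra p .fip Bs Bs∈ = member-nonempty p (member-All p (All.map (∈-code⁻ p) Bs∈))
  code-ultra p .decide B with ultra p (El B)
  ... | inj₁ B∈p  = inj₁ (∈-code⁺ p B∈p)
  ... | inj₂ ∁B∈p = inj₂ (∈-code⁺ p (upward p (El-not B) ∁B∈p))

  recode : βℕ → βℕ
  recode p = decode (code p) (code-ultra p)

  recode-≈ : ∀ p → recode p ≈ p
  recode-≈ p = ⊆⇒≈ {recode p} {p} (λ {A} A∈ → upward p (∈-char⁻ A) (∈-code⁻ p A∈))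

  -- The closed subset of βℕ coded by `𝓕`. Larger families code smaller closed sets, so minimal
  -- closed sets are reached through maximal families.
  Lim : Family → Pred βℕ 0ℓ
  Lim 𝓕 p = ∀ B → B ∈ El 𝓕 → member p (El B)

  Lim-resp-≈ : ∀ 𝓕 {p q} → p ≈ q → p ∈ Lim 𝓕 → q ∈ Lim 𝓕
  Lim-resp-≈ 𝓕 p≈q p∈ B B∈𝓕 = Equivalence.to (p≈q (El B)) (p∈ B B∈𝓕)

  Lim⇒FIP : ∀ {𝓕} p → p ∈ Lim 𝓕 → FIP 𝓕
  Lim⇒FIP p p∈ Bs Bs∈𝓕 = member-nonempty p (member-All p (All.map (p∈ _) Bs∈𝓕))

  ⋃-FIP : ∀ C → ∃ (El C) → El C ⊆ FIP → Chain C → FIP (⋃ C)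
  ⋃-FIP C (𝓐 , 𝓐∈C) C⊆FIP chain Bs Bs∈⋃ =
    let 𝓑 , 𝓑∈C , Bs∈𝓑 = common Bs∈⋃ in C⊆FIP 𝓑∈C Bs Bs∈𝓑
    where
    common : ∀ {Bs} → All (_∈ El (⋃ C)) Bs → ∃ λ 𝓑 → 𝓑 ∈ El C × All (_∈ El 𝓑) Bs
    common []           = 𝓐 , 𝓐∈C , []
    common (B∈⋃ ∷ Bs∈⋃)
      with 𝓑 , 𝓑∈C , B∈𝓑 ← ∈-char⁻ (InSome C) B∈⋃ | 𝓓 , 𝓓∈C , Bs∈𝓓 ← common Bs∈⋃
      with chain 𝓑∈C 𝓓∈C
    ... | inj₁ 𝓑⊑𝓓 = 𝓓 , 𝓓∈C , 𝓑⊑𝓓 B∈𝓑 ∷ Bs∈𝓓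
    ... | inj₂ 𝓓⊑𝓑 = 𝓑 , 𝓑∈C , B∈𝓑 ∷ All.map 𝓓⊑𝓑 Bs∈𝓓

  -- A set meeting every finite intersection from `𝓜` can be adjoined without losing the finite
  -- intersection property, so it already belongs to `𝓜`.
  FIP-maximal⇒IsUltra : ∀ 𝓜 → FIP 𝓜 → (∀ 𝓖 → FIP 𝓖 → 𝓜 ⊑ 𝓖 → 𝓖 ⊑ 𝓜) → IsUltra 𝓜
  FIP-maximal⇒IsUltra 𝓜 𝓜-fip max-𝓜 = record { fip = 𝓜-fip ; decide = split }
    where
    Compatible : Pred (Coded ℕ⁺) 0ℓ
    Compatible B = ∀ Bs → All (_∈ El 𝓜) Bs → ∃ λ n → n ∈ El B × All (λ C → n ∈ El C) Bs

    compatible⇒∈ : Compatible ⊆ El 𝓜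
    compatible⇒∈ {B} compatible =
      max-𝓜 (char Adjoined) adjoined-fip (∈-char⁺ Adjoined ∘ inj₁) (∈-char⁺ Adjoined (inj₂ refl))
      where
      Adjoined : Pred (Coded ℕ⁺) 0ℓ
      Adjoined C = C ∈ El 𝓜 ⊎ C ≡ B

      separate : ∀ {Cs} → All (_∈ El (char Adjoined)) Cs → ∃ λ Bs → All (_∈ El 𝓜) Bs ×
        (∀ {n} → n ∈ El B → All (λ C → n ∈ El C) Bs → All (λ C → n ∈ El C) Cs)
      separate [] = [] , [] , λ _ _ → []
      separate (C∈ ∷ Cs∈) with Bs , Bs∈𝓜 , back ← separate Cs∈ | ∈-char⁻ Adjoined C∈
      ... | inj₁ C∈𝓜 = _ ∷ Bs , C∈𝓜 ∷ Bs∈𝓜 , λ { b (c ∷ bs) → c ∷ back b bs }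
      ... | inj₂ refl = Bs , Bs∈𝓜 , λ b bs → b ∷ back b bs

      adjoined-fip : FIP (char Adjoined)
      adjoined-fip Cs Cs∈ =
        let Bs , Bs∈𝓜 , back = separate Cs∈
            n , n∈B , n∈Bs   = compatible Bs Bs∈𝓜
        in n , back n∈B n∈Bs

    split : ∀ B → B ∈ El 𝓜 ⊎ not ∘ B ∈ El 𝓜
    split B with em {∃ λ Bs → All (_∈ El 𝓜) Bs × ¬ ∃ λ n → n ∈ El B × All (λ C → n ∈ El C) Bs}
    ... | no none = inj₁ (compatible⇒∈ (λ Bs Bs∈𝓜 →
      by-contradiction (λ disjoint → none (Bs , Bs∈𝓜 , disjoint))))
    -- The intersection of `Bs` lies in the complement of `B`, so a common point of `Bs` and `Cs`
    -- shows this complement compatible.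
    ... | yes (Bs , Bs∈𝓜 , disjoint) = inj₂ (compatible⇒∈ (λ Cs Cs∈𝓜 →
      let n , n∈ = 𝓜-fip (Bs List.++ Cs) (Allₚ.++⁺ Bs∈𝓜 Cs∈𝓜)
      in n , El-not B (λ n∈B → disjoint (n , n∈B , Allₚ.++⁻ˡ Bs n∈)) , Allₚ.++⁻ʳ Bs n∈))

  -- Compactness of βℕ.
  extension : ∀ 𝓕 → FIP 𝓕 → ∃ (Lim 𝓕)
  extension 𝓕 𝓕-fip =
    let 𝓤 , 𝓤-fip , 𝓕⊑𝓤 , max-𝓤 = Zorn.maximal FIP 𝓕 𝓕-fip ⋃-FIP
        u = FIP-maximal⇒IsUltra 𝓤 𝓤-fip max-𝓤
    in decode 𝓤 u , λ B B∈𝓕 →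
       closed u (𝓕⊑𝓤 B∈𝓕 ∷ []) (λ { (b ∷ []) → ∈-char⁺ (El B) b })

  -- Idempotents

  -- Quantifying over coded ultrafilters keeps this in `Set`, as `Zorn` requires;
  -- `Semigroup⇒⊕-closed` passes to all of βℕ.
  Semigroup : Pred Family 0ℓ
  Semigroup 𝓕 = ∀ 𝓤 𝓥 (u : IsUltra 𝓤) (v : IsUltra 𝓥) →
    decode 𝓤 u ∈ Lim 𝓕 → decode 𝓥 v ∈ Lim 𝓕 → decode 𝓤 u ⊕ decode 𝓥 v ∈ Lim 𝓕

  Semigroup⇒⊕-closed : ∀ {𝓕} → Semigroup 𝓕 → ∀ p q → p ∈ Lim 𝓕 → q ∈ Lim 𝓕 → p ⊕ q ∈ Lim 𝓕
  Semigroup⇒⊕-closed {𝓕} semigroup p q p∈ q∈ =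
    Lim-resp-≈ 𝓕 {recode p ⊕ recode q} {p ⊕ q}
      (⊕-cong {recode p} {p} {recode q} {q} (recode-≈ p) (recode-≈ q))
      (semigroup _ _ (code-ultra p) (code-ultra q) (recode∈ p p∈) (recode∈ q q∈))
    where
    recode∈ : ∀ r → r ∈ Lim 𝓕 → recode r ∈ Lim 𝓕
    recode∈ r = Lim-resp-≈ 𝓕 {r} {recode r} (≈-sym {recode r} {r} (recode-≈ r))

  -- Lim of a ⊑-maximal 𝓜 is a minimal closed subsemigroup, so for p in it both Lim 𝓜 ⊕ p
  -- and {q ∈ Lim 𝓜 : q ⊕ p ≈ p} are all of Lim 𝓜.
  module Ellis (𝓜 : Family) (⊕-closed : ∀ p q → p ∈ Lim 𝓜 → q ∈ Lim 𝓜 → p ⊕ q ∈ Lim 𝓜)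
               (max-𝓜 : ∀ 𝓖 → FIP 𝓖 × Semigroup 𝓖 → 𝓜 ⊑ 𝓖 → 𝓖 ⊑ 𝓜)
               (p : βℕ) (p∈ : p ∈ Lim 𝓜) where

    -- `Lim translate` is the closure of `Lim 𝓜 ⊕ p`; `fibre-FIP` will show that this translate is
    -- already closed.
    InTranslate : Pred (Coded ℕ⁺) 0ℓ
    InTranslate B = ∀ 𝓤 (u : IsUltra 𝓤) → decode 𝓤 u ∈ Lim 𝓜 → member (decode 𝓤 u ⊕ p) (El B)

    translate : Family
    translate = char InTranslate

    ⊕p∈translate : ∀ q → q ∈ Lim 𝓜 → q ⊕ p ∈ Lim translate
    ⊕p∈translate q q∈ B B∈ =
      Equivalence.to (⊕-cong {recode q} {q} {p} {p} (recode-≈ q) (≈-refl {p}) (El B))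
        (∈-char⁻ InTranslate {B} B∈ _ (code-ultra q)
          (Lim-resp-≈ 𝓜 {q} {recode q} (≈-sym {recode q} {q} (recode-≈ q)) q∈))

    Shifted : Subset → Subset
    Shifted A x = member p (- x +ˢ A)

    shift : Coded ℕ⁺ → Coded ℕ⁺
    shift A = char (Shifted (El A))

    -- `shift A` is in `q` exactly when `El A` is in `q ⊕ p`, so `fibre r` codes the closed set of
    -- all `q` in `Lim 𝓜` with `q ⊕ p ≈ r`.
    InFibre : βℕ → Pred (Coded ℕ⁺) 0ℓ
    InFibre r B = B ∈ El 𝓜 ⊎ ∃ λ A → member r (El A) × B ≡ shift A

    fibre : βℕ → Family
    fibre r = char (InFibre r)

    𝓜⊑fibre : ∀ r → 𝓜 ⊑ fibre r
    𝓜⊑fibre r = ∈-char⁺ (InFibre r) ∘ inj₁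

    Lim-fibre⁺ : ∀ r q → q ∈ Lim 𝓜 → q ⊕ p ≈ r → q ∈ Lim (fibre r)
    Lim-fibre⁺ r q q∈ q⊕p≈r B B∈ with ∈-char⁻ (InFibre r) B∈
    ... | inj₁ B∈𝓜              = q∈ B B∈𝓜
    ... | inj₂ (A , A∈r , refl) =
      upward q (λ {x} → ∈-char⁺ (Shifted (El A)) {x}) (Equivalence.from (q⊕p≈r (El A)) A∈r)

    Lim-fibre⁻ : ∀ r q → q ∈ Lim (fibre r) → q ∈ Lim 𝓜 × q ⊕ p ≈ r
    Lim-fibre⁻ r q q∈ = (λ B → q∈ B ∘ 𝓜⊑fibre r) , ≈-sym {r} {q ⊕ p} (⊆⇒≈ {r} {q ⊕ p} (λ {A} A∈r →
      upward (q ⊕ p) {El (char A)} {A} (∈-char⁻ A) (upward q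
        (λ {x} → ∈-char⁻ (Shifted (El (char A))) {x})
        (q∈ _ (∈-char⁺ (InFibre r) (inj₂ (char A , upward r (∈-char⁺ A) A∈r , refl)))))))

    -- Finitely many conditions reduce to `A ∈ q ⊕ p` for a single `A` in `r`. If no `q` in `Lim 𝓜`
    -- met it, the complement of `A` would be in every `q ⊕ p`, hence in `translate` and in `r`.
    fibre-FIP : ∀ r → r ∈ Lim translate → FIP (fibre r)
    fibre-FIP r r∈ Bs Bs∈ =
      let A , A∈r , sufficient = reduce Bs∈
          𝓤 , u , u∈ , A∈u⊕p  = meets A A∈r
          q                   = decode 𝓤 u
      in member-nonempty q (member-All q (sufficient q u∈ A∈u⊕p))
      where
      reduce : ∀ {Bs} → All (_∈ El (fibre r)) Bs → ∃ λ A → member r A ×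
        (∀ q → q ∈ Lim 𝓜 → member (q ⊕ p) A → All (λ B → member q (El B)) Bs)
      reduce [] = U , whole r , λ _ _ _ → []
      reduce (B∈ ∷ Bs∈) with A , A∈r , sufficient ← reduce Bs∈ | ∈-char⁻ (InFibre r) B∈
      ... | inj₁ B∈𝓜 = A , A∈r , λ q q∈ A∈q⊕p → q∈ _ B∈𝓜 ∷ sufficient q q∈ A∈q⊕p
      ... | inj₂ (A′ , A′∈r , refl) = El A′ ∩ A , meet r A′∈r A∈r , λ q q∈ both →
        upward q (λ {x} → ∈-char⁺ (Shifted (El A′)) {x})
          (upward (q ⊕ p) {El A′ ∩ A} {El A′} proj₁ both) ∷
        sufficient q q∈ (upward (q ⊕ p) {El A′ ∩ A} {A} proj₂ both)

      meets : ∀ A → member r A → ∃ λ 𝓤 → ∃ λ (u : IsUltra 𝓤) →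
        decode 𝓤 u ∈ Lim 𝓜 × member (decode 𝓤 u ⊕ p) A
      meets A A∈r = by-contradiction (λ none → proper r
        (upward r (λ (a , a′) → ∈-char⁻ (∁ A) a′ a)
          (meet r A∈r (r∈ (char (∁ A)) (∈-char⁺ InTranslate {char (∁ A)} (λ 𝓤 u u∈ →
            upward (decode 𝓤 u ⊕ p) {∁ A} {El (char (∁ A))} (∈-char⁺ (∁ A))
              (avoids none 𝓤 u u∈)))))))
        where
        avoids : (¬ ∃ λ 𝓤 → ∃ λ (u : IsUltra 𝓤) → decode 𝓤 u ∈ Lim 𝓜 × member (decode 𝓤 u ⊕ p) A) →
          ∀ 𝓤 u → decode 𝓤 u ∈ Lim 𝓜 → member (decode 𝓤 u ⊕ p) (∁ A)
        avoids none 𝓤 u u∈ with ultra (decode 𝓤 u ⊕ p) A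
        ... | inj₁ A∈  = ⊥-elim (none (𝓤 , u , u∈ , A∈))
        ... | inj₂ ∁A∈ = ∁A∈

    -- If `r ≈ q ⊕ p` and `s ≈ t ⊕ p`, then `r ⊕ s ≈ ((q ⊕ p) ⊕ t) ⊕ p`.
    translate-Semigroup : Semigroup translate
    translate-Semigroup 𝓤 𝓥 u v r∈ s∈ =
      let r = decode 𝓤 u
          s = decode 𝓥 v
          q , q∈ = extension _ (fibre-FIP r r∈)
          t , t∈ = extension _ (fibre-FIP s s∈)
          q∈𝓜 , q⊕p≈r = Lim-fibre⁻ r q q∈
          t∈𝓜 , t⊕p≈s = Lim-fibre⁻ s t t∈
      in Lim-resp-≈ translate {((q ⊕ p) ⊕ t) ⊕ p} {r ⊕ s}
           (≈-trans {((q ⊕ p) ⊕ t) ⊕ p} {(q ⊕ p) ⊕ (t ⊕ p)} {r ⊕ s} (⊕-assoc (q ⊕ p) t p)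
             (⊕-cong {q ⊕ p} {r} {t ⊕ p} {s} q⊕p≈r t⊕p≈s))
           (⊕p∈translate ((q ⊕ p) ⊕ t) (⊕-closed (q ⊕ p) t (⊕-closed q p q∈𝓜 p∈) t∈𝓜))

    p∈translate : p ∈ Lim translate
    p∈translate B B∈ = p∈ B (max-𝓜 translate
      (Lim⇒FIP (p ⊕ p) (⊕p∈translate p p∈) , translate-Semigroup)
      (λ {B} B∈𝓜 → ∈-char⁺ InTranslate {B} (λ 𝓤 u u∈ → ⊕-closed (decode 𝓤 u) p u∈ p∈ B B∈𝓜)) B∈)

    fibre-Semigroup : Semigroup (fibre p)
    fibre-Semigroup 𝓤 𝓥 u v q∈ t∈ =
      let q = decode 𝓤 u
          t = decode 𝓥 v
          q∈𝓜 , q⊕p≈p = Lim-fibre⁻ p q q∈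
          t∈𝓜 , t⊕p≈p = Lim-fibre⁻ p t t∈
      in Lim-fibre⁺ p (q ⊕ t) (⊕-closed q t q∈𝓜 t∈𝓜)
           (≈-trans {(q ⊕ t) ⊕ p} {q ⊕ (t ⊕ p)} {p} (⊕-assoc q t p)
             (≈-trans {q ⊕ (t ⊕ p)} {q ⊕ p} {p}
               (⊕-cong {q} {q} {t ⊕ p} {p} (≈-refl {q}) t⊕p≈p) q⊕p≈p))

    -- As `p` is in the translate, its fibre is nonempty, hence by maximality of `𝓜` all of `Lim 𝓜`;
    -- so it contains `p` itself.
    idempotent : Idempotent p
    idempotent = proj₂ (Lim-fibre⁻ p p (λ B B∈ → p∈ B
      (max-𝓜 (fibre p) (fibre-FIP p p∈translate , fibre-Semigroup) (𝓜⊑fibre p) B∈)))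

  -- Ellis's theorem, with Zorn's lemma run over the families that have the finite intersection
  -- property and code a semigroup.
  idempotent-in-Lim : ∀ 𝓕 p₀ → p₀ ∈ Lim 𝓕 →
    (∀ p q → p ∈ Lim 𝓕 → q ∈ Lim 𝓕 → p ⊕ q ∈ Lim 𝓕) → ∃ λ p → Idempotent p × p ∈ Lim 𝓕
  idempotent-in-Lim 𝓕 p₀ p₀∈ ⊕-closed =
    let 𝓜 , (𝓜-fip , 𝓜-semigroup) , 𝓕⊑𝓜 , max-𝓜 =
          Zorn.maximal (λ 𝓖 → FIP 𝓖 × Semigroup 𝓖) 𝓕
            (Lim⇒FIP p₀ p₀∈ , λ 𝓤 𝓥 u v → ⊕-closed (decode 𝓤 u) (decode 𝓥 v))
            (λ C nonempty good chain →
              ⋃-FIP C nonempty (proj₁ ∘ good) chain , ⋃-Semigroup C (proj₂ ∘ good))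
        p , p∈ = extension 𝓜 𝓜-fip
    in p , Ellis.idempotent 𝓜 (Semigroup⇒⊕-closed 𝓜-semigroup) max-𝓜 p p∈ ,
       λ B → p∈ B ∘ 𝓕⊑𝓜
    where
    ⋃-Semigroup : ∀ C → El C ⊆ Semigroup → Semigroup (⋃ C)
    ⋃-Semigroup C good 𝓤 𝓥 u v p∈ q∈ B B∈⋃
      with 𝓐 , 𝓐∈C , B∈𝓐 ← ∈-char⁻ (InSome C) B∈⋃ =
      good 𝓐∈C 𝓤 𝓥 u v (λ D → p∈ D ∘ ⊑-⋃ C 𝓐∈C) (λ D → q∈ D ∘ ⊑-⋃ C 𝓐∈C) B B∈𝓐

  -- J-sets and almost minimal sequences

  JSet-upward : ∀ {A B} → A ⊆ B → JSet A → JSet B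
  JSet-upward A⊆B JA F with a , H , hit ∷ hits ← JA F = a , H , A⊆B hit ∷ All.map A⊆B hits

  -- Each sequence is replaced by its block sums divided by `z`. A solution `a`, `K` for these
  -- becomes `z * a`, `L`, where `L` is the union of the blocks selected by `K`.
  JSet-preimage : ∀ z {A} → JSet (λ n → z * n ∈ A) → JSet A
  JSet-preimage z {A} J-preimage F@(f ∷ fs) =
    let H , blocks , _ , divs = blockSequence (∃-∣⁺∑-common z (f ∷ fs)) one
        quotients g           = λ i → quotient (∑ (H i) g)
        a , K , hits          = J-preimage (List⁺.map quotients F)
        L , _ , sumL          = merge {H} blocks K
        transfer : ∀ {g} → (∀ i → z ∣⁺ ∑ (H i) g) →
          z * (a + ∑ K (quotients g)) ∈ A → z * a + ∑ L g ∈ A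
        transfer {g} div = subst A (trans (*-distribˡ-+ z a (∑ K (quotients g))) (cong (z * a +_)
          (trans (*-∑ z {quotients g} {λ i → ∑ (H i) g} (λ i → *-quotient (div i)) K)
            (sym (sumL g)))))
    in z * a , L ,
       transfer {f} (λ i → All.head (divs i)) (All.head (All⁺.toList⁺ hits)) ∷
       All.tabulate (λ {g} g∈fs → transfer {g} (λ i → All.lookup (All.tail (divs i)) g∈fs)
         (All.lookup (Allₚ.map⁻ (All.tail (All⁺.toList⁺ hits))) g∈fs))
    where
    -- The default `one` only makes the function total: the block sums of the sequences in `F` are
    -- divisible by `z`.
    quotient : ℕ⁺ → ℕ⁺
    quotient n with em {z ∣⁺ n}
    ... | yes (q , _) = q
    ... | no _        = one

    *-quotient : ∀ {n} → z ∣⁺ n → z * quotient n ≡ n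
    *-quotient {n} z∣n with em {z ∣⁺ n}
    ... | yes (_ , eq) = eq
    ... | no z∤n       = contradiction z∣n z∤n

  -- A solution for the set of `x` with `- x +ˢ A` in `q` yields finitely many translates in `q`; a
  -- common point `y` of them is absorbed into `a`.
  ⊕-J : ∀ p q → p ∈ J → p ⊕ q ∈ J
  ⊕-J p q p∈J A A∈ (f ∷ fs)
    with a , H , hit ∷ hits ← p∈J (λ x → member q (- x +ˢ A)) A∈ (f ∷ fs)
    with y , e ∷ es ← member-nonempty q
           (member-All q {B = λ g → - (a + ∑ H g) +ˢ A} {is = f ∷ fs} (hit ∷ hits)) =
    a + y , H , subst A (swap f) e ∷ All.map (λ {g} → subst A (swap g)) es
    where
    swap : ∀ g → (a + ∑ H g) + y ≡ (a + y) + ∑ H g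
    swap g = trans (+-assoc a (∑ H g) y)
      (trans (cong (a +_) (+-comm (∑ H g) y))
        (sym (+-assoc a y (∑ H g))))

  -- Dilations and C⋆-sets

  scale : ℕ⁺ → βℕ → βℕ
  scale z p = record
    { member = λ A → member p (λ n → z * n ∈ A)
    ; whole  = whole p
    ; proper = proper p
    ; upward = λ A⊆B → upward p A⊆B
    ; meet   = meet p
    ; ultra  = λ A → ultra p (λ n → z * n ∈ A)
    }

  scale-idempotent : ∀ z p → Idempotent p → Idempotent (scale z p)
  scale-idempotent z p p⊕p≈p = ⊆⇒≈ {scale z p ⊕ scale z p} {scale z p} (λ {A} A∈ →
    Equivalence.to (p⊕p≈p (λ n → z * n ∈ A))
      (upward p (λ {x} → upward p (λ {y} → subst A (sym (*-distribˡ-+ z x y)))) A∈))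

  C⋆-dilate : ∀ z {A} → A ∈ C⋆ → (λ n → z * n ∈ A) ∈ C⋆
  C⋆-dilate z A∈C⋆ p idem p∈J =
    A∈C⋆ (scale z p) (scale-idempotent z p idem)
      (λ B B∈ → JSet-preimage z {B} (p∈J (λ n → z * n ∈ B) B∈))

  C⋆-∩ : ∀ {A B} → A ∈ C⋆ → B ∈ C⋆ → A ∩ B ∈ C⋆
  C⋆-∩ A∈C⋆ B∈C⋆ p idem p∈J = meet p (A∈C⋆ p idem p∈J) (B∈C⋆ p idem p∈J)

  -- For `s = ∑ F x`, the tail of sums starting beyond `max F` is in `q`, and adding `s` to such a
  -- sum only joins the index sets.
  ⊕-FS : ∀ x p q → (∀ m → member p (FS x m)) → (∀ m → member q (FS x m)) →
    ∀ m → member (p ⊕ q) (FS x m)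
  ⊕-FS x p q FS∈p FS∈q m = upward p translates (FS∈p m)
    where
    translates : ∀ {s} → FS x m s → member q (- s +ˢ FS x m)
    translates (F , m≤F , refl) = upward q extend (FS∈q (max F + one))
      where
      extend : ∀ {t} → FS x (max F + one) t → FS x m (∑ F x + t)
      extend (G , F<G , refl) =
        let F<G′ = +one≤⇒< {max F} {min G} F<G
        in append F G F<G′ , m≤F , sym (∑-append F G F<G′ x)

  idempotent-of : ∀ x → AlmostMinimal x →
    ∃ λ p → Idempotent p × p ∈ J × (∀ m → member p (FS x m))
  idempotent-of x (p₀ , FS∈p₀ , p₀∈J) =
    let p , idem , p∈ = idempotent-in-Lim family p₀ (∈Lim p₀ p₀∈J FS∈p₀)
          (λ p q p∈ q∈ → ∈Lim (p ⊕ q) (⊕-J p q (Lim⇒J p p∈))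
            (⊕-FS x p q (Lim⇒FS p p∈) (Lim⇒FS q q∈)))
    in p , idem , Lim⇒J p p∈ , Lim⇒FS p p∈
    where
    -- An ultrafilter lies in J(ℕ) exactly when it contains every set whose complement is not a
    -- J-set; so the set to which Ellis's theorem is applied is closed.
    Basic : Pred (Coded ℕ⁺) 0ℓ
    Basic B = ¬ JSet (∁ (El B)) ⊎ ∃ λ m → FS x m ⊆ El B

    family : Family
    family = char Basic

    ∈Lim : ∀ p → p ∈ J → (∀ m → member p (FS x m)) → p ∈ Lim family
    ∈Lim p p∈J FS∈p B B∈ with ∈-char⁻ Basic {B} B∈
    ... | inj₂ (m , FS⊆B) = upward p FS⊆B (FS∈p m)
    ... | inj₁ ¬J∁B with ultra p (El B)
    ...   | inj₁ B∈p  = B∈p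
    ...   | inj₂ ∁B∈p = contradiction (p∈J _ ∁B∈p) ¬J∁B

    Lim⇒J : ∀ p → p ∈ Lim family → p ∈ J
    Lim⇒J p p∈ A A∈p = by-contradiction (λ ¬JA → proper p
      (upward p (λ (a , a′) → ∈-char⁻ (∁ A) a′ a)
        (meet p A∈p (p∈ (char (∁ A)) (∈-char⁺ Basic {char (∁ A)} (inj₁ (λ J∁∁A → ¬JA
          (JSet-upward {∁ (El (char (∁ A)))} {A}
            (λ ¬∁a → by-contradiction (λ ¬a → ¬∁a (∈-char⁺ (∁ A) ¬a))) J∁∁A))))))))
  
    Lim⇒FS : ∀ p → p ∈ Lim family → ∀ m → member p (FS x m)
    Lim⇒FS p p∈ m = upward p (∈-char⁻ (FS x m)) (p∈ (char (FS x m))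
      (∈-char⁺ Basic {char (FS x m)} (inj₂ (m , ∈-char⁺ (FS x m)))))

  -- The sum subsystem

  -- Shared by sums and products. Folding from the largest index down, the later terms give an
  -- element of `E (index j)`, hence of `E (suc (index i))`, and combining it with the term at `i`
  -- lands in `E (index i)`.
  fold∈ : ∀ (_∙_ : ℕ⁺ → ℕ⁺ → ℕ⁺) (y : ℕ → ℕ⁺) (E : ℕ → Subset) →
    (∀ n → y n ∈ E n) → (∀ n → E (suc n) ⊆ E n ∩ (λ s → y n ∙ s ∈ E n)) →
    ∀ F → foldr₁ _∙_ (List⁺.map (y ∘ index) (elements F)) ∈ E 0
  fold∈ _∙_ y E y∈E E-step F =
    antitone (ℕ.z≤n {index (min F)}) (go _ (List⁺.tail (elements F)) (increasing F))
    where
    antitone : ∀ {m n} → m ℕ.≤ n → E n ⊆ E m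
    antitone {n = n} m≤n with ℕₚ.m≤n⇒m<n∨m≡n m≤n
    antitone {n = n}     m≤n | inj₂ refl           = id
    antitone {n = suc n} m≤n | inj₁ (ℕ.s≤s m≤n′) = antitone m≤n′ ∘ proj₁ ∘ E-step n

    go : ∀ i is → AllPairs _<_ (i ∷ is) →
      foldr₁ _∙_ (List⁺.map (y ∘ index) (i ∷ is)) ∈ E (index i)
    go i []       _                   = y∈E (index i)
    go i (j ∷ is) ((i<j ∷ _) ∷ inc) =
      proj₂ (E-step (index i) (antitone (index-mono-< {i} {j} i<j) (go j is inc)))

  module Subsystem (x : Sequence) (p : βℕ) (p⊕p≈p : Idempotent p) (p∈J : p ∈ J)
                   (FS∈p : ∀ m → member p (FS x m)) (A : Subset) (A∈C⋆ : A ∈ C⋆) where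

    -- Sums of later terms have to stay in sumTarget and products in productTarget.
    record Stage : Set₁ where
      field
        lower         : ℕ⁺
        sumTarget     : Subset
        sum∈p         : member p sumTarget
        productTarget : Subset
        product∈C⋆    : productTarget ∈ C⋆

    open Stage

    Good : Stage → Subset
    Good S n = n ∈ sumTarget S × n ∈ productTarget S × member p (- n +ˢ sumTarget S)

    choose : ∀ S → ∃ λ H → lower S ≤ min H × ∑ H x ∈ Good S
    -- All four sets are in `p`, the last because `p ⊕ p ≈ p`, so they have a common point.
    choose S with _ , (H , l≤H , refl) , good ← member-nonempty p (meet p (FS∈p (lower S))
        (meet p (sum∈p S) (meet p (product∈C⋆ S p p⊕p≈p p∈J)
          (Equivalence.from (p⊕p≈p (sumTarget S)) (sum∈p S))))) = H , l≤H , good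

    block : Stage → 𝒫f
    block S = proj₁ (choose S)

    term : Stage → ℕ⁺
    term S = ∑ (block S) x

    good : ∀ S → term S ∈ Good S
    good S = proj₂ (proj₂ (choose S))

    advance : Stage → Stage
    advance S = record
      { lower         = max (block S) + one
      ; sumTarget     = sumTarget S ∩ - term S +ˢ sumTarget S
      ; sum∈p         = meet p (sum∈p S) (proj₂ (proj₂ (good S)))
      ; productTarget = productTarget S ∩ (λ n → term S * n ∈ productTarget S)
      ; product∈C⋆    = C⋆-∩ (product∈C⋆ S) (C⋆-dilate (term S) (product∈C⋆ S))
      }

    stage : ℕ → Stage
    stage zero = record
      { lower = one
      ; sumTarget = A ; sum∈p = A∈C⋆ p p⊕p≈p p∈J
      ; productTarget = A ; product∈C⋆ = A∈C⋆
      }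
    stage (suc n) = advance (stage n)

    y : Sequence
    y = term ∘ stage ∘ index

    consecutive : ∀ S → max (block S) < min (block (advance S))
    consecutive S = +one≤⇒< {max (block S)} {min (block (advance S))}
      (proj₁ (proj₂ (choose (advance S))))

    -- `index (n + one)` does not reduce to `suc (index n)`; with `l` a variable the equation can be
    -- matched.
    separated : ∀ k {l} → l ≡ suc k → max (block (stage k)) < min (block (stage l))
    separated k refl = consecutive (stage k)

    y-subsystem : SumSubsystem y x
    y-subsystem = block ∘ stage ∘ index , (λ n → separated (index n) (index-+one n)) , λ _ → refl

    FS∪FP⊆A : FS y one ∪ FP y one ⊆ A
    FS∪FP⊆A (inj₁ (F , _ , refl)) =
      -- Each target set by `advance` is by definition the intersection that `fold∈` asks for, hence
      -- `id`.
      fold∈ _+_ (term ∘ stage) (sumTarget ∘ stage) (proj₁ ∘ good ∘ stage) (λ _ → id) F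
    FS∪FP⊆A (inj₂ (F , _ , refl)) =
      fold∈ _*_ (term ∘ stage) (productTarget ∘ stage) (proj₁ ∘ proj₂ ∘ good ∘ stage) (λ _ → id) F

theorem2p10 : ExcludedMiddle 0ℓ → Extensionality 0ℓ 0ℓ →
    (x : Sequence) → AlmostMinimal x →
    (A : Subset) → A ∈ C⋆ →
    ∃ λ (y : Sequence) → SumSubsystem y x × (FS y one ∪ FP y one) ⊆ A
theorem2p10 em ext x x-minimal A A∈C⋆ =
  let open Classical em ext
      p , p⊕p≈p , p∈J , FS∈p = idempotent-of x x-minimal
      open Subsystem x p p⊕p≈p p∈J FS∈p A A∈C⋆
  in y , y-subsystem , FS∪FP⊆A
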